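{- Let $A\cup\{\varphi\}$ be a finite set of formulas of $\mathcal{L}$. If $A\vdash_{\mathsf{IntCK}}\varphi$, then the nested sequent $\bullet A,\circ\varphi$ is derivable in $\mathsf{N.IntCK}$, where $\bullet A=\{\bullet\gamma\mid\gamma\in A\}$.
   Context: Language $\mathcal{L}$: formulas $\varphi ::= p \mid \bot \mid \varphi\wedge\varphi \mid \varphi\vee\varphi \mid \varphi\to\varphi \mid \varphi \mathbin{\Box\!\!\rightarrow} \varphi \mid \varphi \mathbin{\Diamond\!\!\rightarrow}\varphi$; $\wedge,\vee$ bind more strongly than $\to,\mathbin{\Box\!\!\rightarrow},\mathbin{\Diamond\!\!\rightarrow}$; $\neg\varphi:=\varphi\to\bot$, $\top:=\neg\bot$, $\varphi\leftrightarrow\psi:=(\varphi\to\psi)\wedge(\psi\to\varphi)$. $\mathsf{IntCK}$: an axiomatisation of intuitionistic propositional logic in $\mathcal{L}$ (with modus ponens) plus axioms CM$_\Box$: $(\varphi\mathbin{\Box\!\!\rightarrow}\psi\wedge\chi)\to(\varphi\mathbin{\Box\!\!\rightarrow}\psi)\wedge(\varphi\mathbin{\Box\!\!\rightarrow}\chi)$; CC$_\Box$: $(\varphi\mathbin{\Box\!\!\rightarrow}\psi)\wedge(\varphi\mathbin{\Box\!\!\rightarrow}\chi)\to(\varphi\mathbin{\Box\!\!\rightarrow}\psi\wedge\chi)$; CN$_\Box$: $\varphi\mathbin{\Box\!\!\rightarrow}\top$; CM$_\Diamond$: $(\varphi\mathbin{\Diamond\!\!\rightarrow}\psi)\vee(\varphi\mathbin{\Diamond\!\!\rightarrow}\chi)\to(\varphi\mathbin{\Diamond\!\!\rightarrow}\psi\vee\chi)$;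 CC$_\Diamond$: $(\varphi\mathbin{\Diamond\!\!\rightarrow}\psi\vee\chi)\to(\varphi\mathbin{\Diamond\!\!\rightarrow}\psi)\vee(\varphi\mathbin{\Diamond\!\!\rightarrow}\chi)$; CN$_\Diamond$: $\neg(\varphi\mathbin{\Diamond\!\!\rightarrow}\bot)$; CW: $(\varphi\mathbin{\Diamond\!\!\rightarrow}\psi)\wedge(\varphi\mathbin{\Box\!\!\rightarrow}\chi)\to(\varphi\mathbin{\Diamond\!\!\rightarrow}\psi\wedge\chi)$; CFS: $((\varphi\mathbin{\Diamond\!\!\rightarrow}\psi)\to(\varphi\mathbin{\Box\!\!\rightarrow}\chi))\to(\varphi\mathbin{\Box\!\!\rightarrow}(\psi\to\chi))$; and rules RA$_\Box$: from $\varphi\leftrightarrow\rho$ infer $(\varphi\mathbin{\Box\!\!\rightarrow}\psi)\leftrightarrow(\rho\mathbin{\Box\!\!\rightarrow}\psi)$; RC$_\Box$: from $\psi\leftrightarrow\chi$ infer $(\varphi\mathbin{\Box\!\!\rightarrow}\psi)\leftrightarrow(\varphi\mathbin{\Box\!\!\rightarrow}\chi)$; RA$_\Diamond$, RC$_\Diamond$ likewise with $\mathbin{\Diamond\!\!\rightarrow}$. $A\vdash_{\mathsf{IntCK}}\varphi$ means there are $\psi_1,\dots,\psi_n\in A$ with $\psi_1\wedge\dots\wedge\psi_n\to\varphi$ derivable in $\mathsf{IntCK}$. Nested sequents: input formulas $\bullet\varphi$, output formulas $\circ\varphi$. Input sequents $\Lambda ::= \emptyset \mid \Lambda,\bullet\varphi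 \mid \Lambda,[\psi:\Lambda']$; nested sequents $\Gamma ::= \Lambda,\circ\varphi \mid \Lambda,[\psi:\Gamma']$ ($\psi\in\mathcal{L}$ the index, comma = multiset union). Contexts $\Gamma\{\,\}$: $\{\,\}$ is a context; if $\Delta$ is a sequent and $\Gamma\{\,\}$ a context then $\Delta,\Gamma\{\,\}$ and $[\varphi:\Gamma\{\,\}]$ are contexts; $\Gamma\{\Sigma\}$ fills the hole (only fillings yielding input/nested sequents allowed); $\Gamma^\downarrow\{\,\}$ deletes the output formula of $\Gamma\{\,\}$, if any. Rules of $\mathsf{N.IntCK}$ (premisses / conclusion): init: $\Gamma\{\bullet p,\circ p\}$; $\bot^\bullet$: $\Gamma\{\bullet\bot\}$; $\wedge^\bullet$: $\Gamma\{\bullet\varphi,\bullet\psi\}$ / $\Gamma\{\bullet(\varphi\wedge\psi)\}$; $\wedge^\circ$: $\Gamma\{\circ\varphi\}$, $\Gamma\{\circ\psi\}$ / $\Gamma\{\circ(\varphi\wedge\psi)\}$; $\vee^\bullet$: $\Gamma\{\bullet\varphi\}$, $\Gamma\{\bullet\psi\}$ / $\Gamma\{\bullet(\varphi\vee\psi)\}$; $\vee^\circ$: $\Gamma\{\circ\varphi\}$ / $\Gamma\{\circ(\varphi\vee\psi)\}$ and $\Gamma\{\circ\psi\}$ / $\Gamma\{\circ(\varphi\vee\psi)\}$; $\to^\bullet$: $\Gamma^\downarrow\{\bullet(\varphi\to\psi),\circ\varphi\}$, $\Gamma\{\bullet\psi\}$ / $\Gamma\{\bullet(\varphi\to\psi)\}$;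 $\to^\circ$: $\Gamma\{\bullet\varphi,\circ\psi\}$ / $\Gamma\{\circ(\varphi\to\psi)\}$; $\Box^\bullet$: $\bullet\varphi,\circ\eta$; $\bullet\eta,\circ\varphi$; $\Gamma\{\bullet(\varphi\mathbin{\Box\!\!\rightarrow}\psi),[\eta:\bullet\psi,\Delta]\}$ / $\Gamma\{\bullet(\varphi\mathbin{\Box\!\!\rightarrow}\psi),[\eta:\Delta]\}$; $\Box^\circ$: $\Gamma\{[\varphi:\circ\psi]\}$ / $\Gamma\{\circ(\varphi\mathbin{\Box\!\!\rightarrow}\psi)\}$; $\Diamond^\bullet$: $\Gamma\{[\varphi:\bullet\psi]\}$ / $\Gamma\{\bullet(\varphi\mathbin{\Diamond\!\!\rightarrow}\psi)\}$; $\Diamond^\circ$: $\bullet\varphi,\circ\eta$; $\bullet\eta,\circ\varphi$; $\Gamma\{[\eta:\circ\psi,\Delta]\}$ / $\Gamma\{\circ(\varphi\mathbin{\Diamond\!\!\rightarrow}\psi),[\eta:\Delta]\}$. Derivations are finite trees with leaves instances of init or $\bot^\bullet$. -}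

module Defs where

open import Data.Nat using (ℕ)
open import Data.List using (List; []; _∷_; _++_; map)
open import Data.List.Membership.Propositional using (_∈_)
open import Data.List.Relation.Unary.All using (All)
open import Data.List.Relation.Binary.Permutation.Propositional using (_↭_)
open import Data.Product using (Σ; _×_)

infixr 6 _∧_
infixr 5 _∨_
infixr 4 _⇒_ _□→_ _◇→_ _⇔_

data Fm : Set where
  var  : ℕ → Fm
  ⊥'   : Fm
  _∧_  : Fm → Fm → Fm
  _∨_  : Fm → Fm → Fm
  _⇒_  : Fm → Fm → Fm
  _□→_ : Fm → Fm → Fm
  _◇→_ : Fm → Fm → Fm

¬' : Fm → Fm
¬' φ = φ ⇒ ⊥'

⊤' : Fm
⊤' = ¬' ⊥'

_⇔_ : Fm → Fm → Fm
φ ⇔ ψ = (φ ⇒ ψ) ∧ (ψ ⇒ φ)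

data ⊢_ : Fm → Set where
  ax-K   : ∀ {φ ψ} → ⊢ (φ ⇒ (ψ ⇒ φ))
  ax-S   : ∀ {φ ψ χ} → ⊢ ((φ ⇒ (ψ ⇒ χ)) ⇒ ((φ ⇒ ψ) ⇒ (φ ⇒ χ)))
  ax-∧E₁ : ∀ {φ ψ} → ⊢ (φ ∧ ψ ⇒ φ)
  ax-∧E₂ : ∀ {φ ψ} → ⊢ (φ ∧ ψ ⇒ ψ)
  ax-∧I  : ∀ {φ ψ} → ⊢ (φ ⇒ (ψ ⇒ φ ∧ ψ))
  ax-∨I₁ : ∀ {φ ψ} → ⊢ (φ ⇒ φ ∨ ψ)
  ax-∨I₂ : ∀ {φ ψ} → ⊢ (ψ ⇒ φ ∨ ψ)
  ax-∨E  : ∀ {φ ψ χ} → ⊢ ((φ ⇒ χ) ⇒ ((ψ ⇒ χ) ⇒ (φ ∨ ψ ⇒ χ)))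
  ax-⊥E  : ∀ {φ} → ⊢ (⊥' ⇒ φ)
  mp     : ∀ {φ ψ} → ⊢ (φ ⇒ ψ) → ⊢ φ → ⊢ ψ
  CM□ : ∀ {φ ψ χ} → ⊢ ((φ □→ ψ ∧ χ) ⇒ (φ □→ ψ) ∧ (φ □→ χ))
  CC□ : ∀ {φ ψ χ} → ⊢ ((φ □→ ψ) ∧ (φ □→ χ) ⇒ (φ □→ ψ ∧ χ))
  CN□ : ∀ {φ} → ⊢ (φ □→ ⊤')
  CM◇ : ∀ {φ ψ χ} → ⊢ ((φ ◇→ ψ) ∨ (φ ◇→ χ) ⇒ (φ ◇→ ψ ∨ χ))
  CC◇ : ∀ {φ ψ χ} → ⊢ ((φ ◇→ ψ ∨ χ) ⇒ (φ ◇→ ψ) ∨ (φ ◇→ χ))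
  CN◇ : ∀ {φ} → ⊢ ¬' (φ ◇→ ⊥')
  CW  : ∀ {φ ψ χ} → ⊢ ((φ ◇→ ψ) ∧ (φ □→ χ) ⇒ (φ ◇→ ψ ∧ χ))
  CFS : ∀ {φ ψ χ} → ⊢ (((φ ◇→ ψ) ⇒ (φ □→ χ)) ⇒ (φ □→ (ψ ⇒ χ)))
  RA□ : ∀ {φ ρ ψ} → ⊢ (φ ⇔ ρ) → ⊢ ((φ □→ ψ) ⇔ (ρ □→ ψ))
  RC□ : ∀ {φ ψ χ} → ⊢ (ψ ⇔ χ) → ⊢ ((φ □→ ψ) ⇔ (φ □→ χ))
  RA◇ : ∀ {φ ρ ψ} → ⊢ (φ ⇔ ρ) → ⊢ ((φ ◇→ ψ) ⇔ (ρ ◇→ ψ))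
  RC◇ : ∀ {φ ψ χ} → ⊢ (ψ ⇔ χ) → ⊢ ((φ ◇→ ψ) ⇔ (φ ◇→ χ))

⋀ : List Fm → Fm
⋀ []       = ⊤'
⋀ (ψ ∷ []) = ψ
⋀ (ψ ∷ ψs) = ψ ∧ ⋀ ψs

_⊢IntCK_ : List Fm → Fm → Set
A ⊢IntCK φ = Σ (List Fm) λ ψs → All (_∈ A) ψs × (⊢ (⋀ ψs ⇒ φ))

-- Nested sequents (lists of items, read as multisets via the exchange
-- rule `ex` below, which acts at any depth through contexts)

data Item : Set where
  •_   : Fm → Item
  ∘_   : Fm → Item
  [_∶_] : Fm → List Item → Item

Seq : Set
Seq = List Item

data Ctx : Set where
  hole : Ctx
  _,,_ : Seq → Ctx → Ctx
  box  : Fm → Ctx → Ctx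

_⟨_⟩ : Ctx → Seq → Seq
hole     ⟨ Σ' ⟩ = Σ'
(Δ ,, Γ) ⟨ Σ' ⟩ = Δ ++ (Γ ⟨ Σ' ⟩)
box φ Γ  ⟨ Σ' ⟩ = [ φ ∶ Γ ⟨ Σ' ⟩ ] ∷ []

mutual
  delOutS : Seq → Seq
  delOutS []       = []
  delOutS (i ∷ is) = delOutI i ++ delOutS is

  delOutI : Item → Seq
  delOutI (• φ)       = (• φ) ∷ []
  delOutI (∘ φ)       = []
  delOutI [ φ ∶ Δ ]   = [ φ ∶ delOutS Δ ] ∷ []

_↓ : Ctx → Ctx
hole ↓     = hole
(Δ ,, Γ) ↓ = delOutS Δ ,, (Γ ↓)
box φ Γ ↓  = box φ (Γ ↓)

data N⊢_ : Seq → Set where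
  ex   : ∀ Γ {Σ₁ Σ₂} → Σ₁ ↭ Σ₂ → N⊢ (Γ ⟨ Σ₁ ⟩) → N⊢ (Γ ⟨ Σ₂ ⟩)
  init : ∀ Γ p → N⊢ (Γ ⟨ (• var p) ∷ (∘ var p) ∷ [] ⟩)
  ⊥•   : ∀ Γ → N⊢ (Γ ⟨ (• ⊥') ∷ [] ⟩)
  ∧•   : ∀ Γ {φ ψ} → N⊢ (Γ ⟨ (• φ) ∷ (• ψ) ∷ [] ⟩) → N⊢ (Γ ⟨ (• (φ ∧ ψ)) ∷ [] ⟩)
  ∧∘   : ∀ Γ {φ ψ} → N⊢ (Γ ⟨ (∘ φ) ∷ [] ⟩) → N⊢ (Γ ⟨ (∘ ψ) ∷ [] ⟩)
         → N⊢ (Γ ⟨ (∘ (φ ∧ ψ)) ∷ [] ⟩)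
  ∨•   : ∀ Γ {φ ψ} → N⊢ (Γ ⟨ (• φ) ∷ [] ⟩) → N⊢ (Γ ⟨ (• ψ) ∷ [] ⟩)
         → N⊢ (Γ ⟨ (• (φ ∨ ψ)) ∷ [] ⟩)
  ∨∘₁  : ∀ Γ {φ ψ} → N⊢ (Γ ⟨ (∘ φ) ∷ [] ⟩) → N⊢ (Γ ⟨ (∘ (φ ∨ ψ)) ∷ [] ⟩)
  ∨∘₂  : ∀ Γ {φ ψ} → N⊢ (Γ ⟨ (∘ ψ) ∷ [] ⟩) → N⊢ (Γ ⟨ (∘ (φ ∨ ψ)) ∷ [] ⟩)
  ⇒•   : ∀ Γ {φ ψ} → N⊢ ((Γ ↓) ⟨ (• (φ ⇒ ψ)) ∷ (∘ φ) ∷ [] ⟩) → N⊢ (Γ ⟨ (• ψ) ∷ [] ⟩)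
         → N⊢ (Γ ⟨ (• (φ ⇒ ψ)) ∷ [] ⟩)
  ⇒∘   : ∀ Γ {φ ψ} → N⊢ (Γ ⟨ (• φ) ∷ (∘ ψ) ∷ [] ⟩) → N⊢ (Γ ⟨ (∘ (φ ⇒ ψ)) ∷ [] ⟩)
  □•   : ∀ Γ {φ ψ η Δ} → N⊢ ((• φ) ∷ (∘ η) ∷ []) → N⊢ ((• η) ∷ (∘ φ) ∷ [])
         → N⊢ (Γ ⟨ (• (φ □→ ψ)) ∷ [ η ∶ (• ψ) ∷ Δ ] ∷ [] ⟩)
         → N⊢ (Γ ⟨ (• (φ □→ ψ)) ∷ [ η ∶ Δ ] ∷ [] ⟩)
  □∘   : ∀ Γ {φ ψ} → N⊢ (Γ ⟨ [ φ ∶ (∘ ψ) ∷ [] ] ∷ [] ⟩) → N⊢ (Γ ⟨ (∘ (φ □→ ψ)) ∷ [] ⟩)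
  ◇•   : ∀ Γ {φ ψ} → N⊢ (Γ ⟨ [ φ ∶ (• ψ) ∷ [] ] ∷ [] ⟩) → N⊢ (Γ ⟨ (• (φ ◇→ ψ)) ∷ [] ⟩)
  ◇∘   : ∀ Γ {φ ψ η Δ} → N⊢ ((• φ) ∷ (∘ η) ∷ []) → N⊢ ((• η) ∷ (∘ φ) ∷ [])
         → N⊢ (Γ ⟨ [ η ∶ (∘ ψ) ∷ Δ ] ∷ [] ⟩)
         → N⊢ (Γ ⟨ (∘ (φ ◇→ ψ)) ∷ [ η ∶ Δ ] ∷ [] ⟩)

•_,∘_ : List Fm → Fm → Seq
• A ,∘ φ = map •_ A ++ (∘ φ) ∷ []

{-# OPTIONS --safe #-}
module Submission where

-- Semantic cut elimination. Formulas are interpreted as predicates on the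
-- nodes of nested sequents, closed under the continuation monad whose answer
-- is cut-free derivability. The interpretation is sound for the Hilbert system
-- IntCK, a node carrying •φ satisfies ⟦φ⟧, and a sequent with ∘φ at a node
-- satisfying ⟦φ⟧ is derivable; composing the three yields the theorem.
-- The left rules are not cumulative, so the accessibility
-- order only asks that an input formula survive in decomposed form (`Has`);
-- this makes contraction unnecessary. And φ □→ ψ, φ ◇→ ψ must depend on φ only
-- through ⟦φ⟧, so they range over the indices η that represent ⟦φ⟧ (`Rep`),
-- meaning that •η forces ⟦φ⟧ and ⟦φ⟧ makes ∘η derivable.

open import Defs
open import Data.Bool using (Bool; true; false)
open import Data.Empty using (⊥)
open import Data.List using (List; []; _∷_; _++_; map)
open import Data.List.Membership.Propositional using (_∈_)
open import Data.List.Membership.Propositional.Properties using (∈-++⁺ˡ; ∈-++⁺ʳ; ∈-map⁺)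
open import Data.List.Relation.Binary.Permutation.Propositional using (_↭_; ↭-refl; ↭-sym; ↭-trans; prep; swap)
open import Data.List.Relation.Binary.Permutation.Propositional.Properties using (shift; ++⁺ˡ; ++⁺ʳ; ++-identityʳ)
open import Data.List.Relation.Binary.Subset.Propositional using (_⊆_)
open import Data.List.Relation.Unary.All as All using (All; []; _∷_)
open import Data.List.Relation.Unary.Any using (here; there; _─_)
open import Data.List.Relation.Unary.Unique.Propositional using (Unique)
open import Data.Product using (_×_; _,_; proj₁; proj₂; ∃-syntax)
open import Data.Sum using (_⊎_; inj₁; inj₂)
open import Function using (_∘_; id)
open import Relation.Binary.PropositionalEquality using (_≡_; refl; sym; trans; cong; subst)

private
  variable
    A : Set
    a b : A
    as : List A
    S S' S'' Δ Δ' R R' : Seq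
    φ ψ χ η : Fm
    it it' : Item
    m : Bool

-- Removing a list element

-- `inj₁` arises only when the two positions coincide: an equal item elsewhere in the list counts as
-- surviving the removal.
compare : (i : a ∈ as) → b ∈ as → (b ≡ a) ⊎ (b ∈ (as ─ i))
compare (here refl) (here refl) = inj₁ refl
compare (here refl) (there j)   = inj₂ j
compare (there i)   (here refl) = inj₂ (here refl)
compare (there i)   (there j) with compare i j
... | inj₁ eq = inj₁ eq
... | inj₂ k  = inj₂ (there k)

compare-refl : (i : a ∈ as) → compare i i ≡ inj₁ refl
compare-refl (here refl) = refl
compare-refl (there i) rewrite compare-refl i = refl

↭-remove : (i : a ∈ as) → a ∷ (as ─ i) ↭ as
↭-remove (here refl) = ↭-refl
↭-remove (there i)   = ↭-trans (↭-sym (shift _ (_ ∷ []) _)) (prep _ (↭-remove i))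

↭-readd : {as : List A} (i : a ∈ as) (bs : List A) → (as ─ i) ++ a ∷ bs ↭ as ++ bs
↭-readd {as = as} i bs = ↭-trans (shift _ (as ─ i) bs) (++⁺ʳ bs (↭-remove i))

↭-readd₁ : {as : List A} (i : a ∈ as) → (as ─ i) ++ a ∷ [] ↭ as
↭-readd₁ i = ↭-trans (↭-readd i []) (++-identityʳ _)

-- Nodes of a nested sequent

data Node : Seq → Set where
  root : Node S
  down : [ η ∶ Δ ] ∈ S → Node Δ → Node S

content : Node S → Seq
content {S} root  = S
content (down _ x) = content x

-- A relation rather than a bracket position: homomorphisms preserve the index of a child, while its
-- content and its place in the list may change.
data Child : Node S → Fm → Node S → Set where
  top : (i : [ η ∶ Δ ] ∈ S) → Child {S} root η (down i root)
  sub : {i : [ χ ∶ Δ ] ∈ S} {x y : Node Δ} → Child x η y → Child {S} (down i x) η (down i y)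

_⊕_ : (x : Node S) → Node (content x) → Node S
root     ⊕ z = z
down i x ⊕ z = down i (x ⊕ z)

⊕-root : (x : Node S) → x ⊕ root ≡ x
⊕-root root       = refl
⊕-root (down i x) = cong (down i) (⊕-root x)

Child-⊕ : {x y : Node S} → Child x η y →
          ∃[ Δ ] ∃[ i ] y ≡ x ⊕ down {η = η} {Δ = Δ} i root
Child-⊕ (top i) = _ , i , refl
Child-⊕ (sub c) with Child-⊕ c
... | _ , i , refl = _ , i , refl

⊕-child : (x : Node S) (i : [ η ∶ Δ ] ∈ content x) → Child x η (x ⊕ down i root)
⊕-child root       i = top i
⊕-child (down _ x) i = sub (⊕-child x i)

content-⊕ : (x : Node S) (z : Node (content x)) → content (x ⊕ z) ≡ content z
content-⊕ root       z = refl
content-⊕ (down _ x) z = content-⊕ x z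

∈-⊕ : (x : Node S) (i : [ η ∶ Δ ] ∈ content x) → it ∈ Δ → it ∈ content (x ⊕ down i root)
∈-⊕ x i = subst (_ ∈_) (sym (content-⊕ x (down i root)))

-- There is no constructor for □→, whose left rule keeps its principal formula.
data Has : Node S → Fm → Set where
  mem  : {x : Node S} → (• φ) ∈ content x → Has x φ
  and  : {x : Node S} → Has x φ → Has x ψ → Has x (φ ∧ ψ)
  or₁  : {x : Node S} → Has x φ → Has x (φ ∨ ψ)
  or₂  : {x : Node S} → Has x ψ → Has x (φ ∨ ψ)
  imp  : {x : Node S} → Has x ψ → Has x (φ ⇒ ψ)
  dia  : {x y : Node S} → Child x φ y → Has y ψ → Has x (φ ◇→ ψ)

-- Homomorphisms of nested sequents

record Hom (S S' : Seq) : Set where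
  field
    fun   : Node S → Node S'
    child : ∀ {x η y} → Child x η y → Child (fun x) η (fun y)
    input : ∀ {x φ} → (• φ) ∈ content x → Has (fun x) φ
open Hom

Has-mono : (h : Hom S S') {x : Node S} → Has x φ → Has (fun h x) φ
Has-mono h (mem i)   = input h i
Has-mono h (and p q) = and (Has-mono h p) (Has-mono h q)
Has-mono h (or₁ p)   = or₁ (Has-mono h p)
Has-mono h (or₂ p)   = or₂ (Has-mono h p)
Has-mono h (imp p)   = imp (Has-mono h p)
Has-mono h (dia c p) = dia (child h c) (Has-mono h p)

-- Kept apart from `Hom`: right rules consume their principal output and the left premiss of `⇒•`
-- deletes the outputs of its context, yet the interpretation must persist into these premisses.
Outputs : Hom S S' → Set
Outputs h = ∀ x {χ} → (∘ χ) ∈ content x → (∘ χ) ∈ content (fun h x)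

idHom : Hom S S
idHom = record { fun = id ; child = id ; input = mem }

infixr 9 _⨾_
_⨾_ : Hom S S' → Hom S' S'' → Hom S S''
h ⨾ k = record { fun = fun k ∘ fun h ; child = child k ∘ child h ; input = Has-mono k ∘ input h }

-- Root-preserving homomorphisms, presented item by item so that they can be
-- built by recursion on sequents; outputs are preserved when m is true.

data _≼[_]_ : Item → Bool → Seq → Set

Sim : Bool → Seq → Seq → Set
Sim m S S' = ∀ {it} → it ∈ S → it ≼[ m ] S'

data _≼[_]_ where
  inp : Has {R} root φ → (• φ) ≼[ m ] R
  out : (m ≡ true → (∘ χ) ∈ R) → (∘ χ) ≼[ m ] R
  box : [ η ∶ Δ' ] ∈ R → (∀ {it} → it ∈ Δ → it ≼[ m ] Δ') → [ η ∶ Δ ] ≼[ m ] R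

simFun : Sim m S S' → Node S → Node S'
simFun s root = root
simFun s (down i x) with s i
... | box i' s' = down i' (simFun s' x)

Has-down : (i : [ η ∶ Δ ] ∈ S) {x : Node Δ} → Has x φ → Has (down i x) φ
Has-down i (mem j)   = mem j
Has-down i (and p q) = and (Has-down i p) (Has-down i q)
Has-down i (or₁ p)   = or₁ (Has-down i p)
Has-down i (or₂ p)   = or₂ (Has-down i p)
Has-down i (imp p)   = imp (Has-down i p)
Has-down i (dia c p) = dia (sub c) (Has-down i p)

simChild : (s : Sim m S S') {x y : Node S} → Child x η y → Child (simFun s x) η (simFun s y)
simChild s (top i) with s i
... | box i' s' = top i'
simChild s (sub {i = i} c) with s i
... | box i' s' = sub (simChild s' c)

simInput : (s : Sim m S S') (x : Node S) → (• φ) ∈ content x → Has (simFun s x) φ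
simInput s root j with s j
... | inp p = p
simInput s (down i x) j with s i
... | box i' s' = Has-down i' (simInput s' x j)

simHom : Sim m S S' → Hom S S'
simHom s = record { fun = simFun s ; child = simChild s ; input = λ {x} → simInput s x }

simOutput : (s : Sim true S S') → Outputs (simHom s)
simOutput s root j with s j
... | out p = p refl
simOutput s (down i x) j with s i
... | box i' s' = simOutput s' x j

⊆-sim  : S ⊆ S' → Sim m S S'
∈⇒≼    : ∀ it → it ∈ S → it ≼[ m ] S
⊆-sim {S = _ ∷ _} inc (here refl) = ∈⇒≼ _ (inc (here refl))
⊆-sim {S = _ ∷ _} inc (there j)   = ⊆-sim (inc ∘ there) j
∈⇒≼ (• φ)     i = inp (mem i)
∈⇒≼ (∘ φ)     i = out λ _ → i
∈⇒≼ [ φ ∶ Δ ] i = box i (⊆-sim id)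

id-sim : ∀ S → Sim m S S
id-sim _ = ∈⇒≼ _

≼-weaken : R ⊆ R' → it ≼[ m ] R → it ≼[ m ] R'
≼-weaken inc (inp p)   = inp (Has-mono (simHom (⊆-sim {m = true} inc)) p)
≼-weaken inc (out p)   = out (inc ∘ p)
≼-weaken inc (box i s) = box (inc i) s

delOut-sim  : ∀ S → Sim false S (delOutS S)
delOut-item : ∀ it → it ≼[ false ] delOutI it
delOut-sim (it ∷ S) (here refl) = ≼-weaken ∈-++⁺ˡ (delOut-item it)
delOut-sim (it ∷ S) (there j)   = ≼-weaken (∈-++⁺ʳ (delOutI it)) (delOut-sim S j)
delOut-item (• φ)     = inp (mem (here refl))
delOut-item (∘ φ)     = out λ ()
delOut-item [ φ ∶ Δ ] = box (here refl) (delOut-sim Δ)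

-- Replacing the content of a node

-- The operation K acts on the material off the path to x: the identity for
-- most rules, deletion of outputs for the left premiss of ⇒•.
wrap : (K : Seq → Seq) → Node S → Seq → Seq
wrap K root R = R
wrap K (down {η = η} {S = S} i x) R = K (S ─ i) ++ [ η ∶ wrap K x R ] ∷ []

module _ {K : Seq → Seq} (κ : ∀ S → Sim m S (K S)) where

  wrapSim : (x : Node S) → Sim m (content x) R → Sim m S (wrap K x R)
  wrapSim root s = s
  wrapSim (down {S = S} i x) s j with compare i j
  ... | inj₁ refl = box (∈-++⁺ʳ (K (S ─ i)) (here refl)) (wrapSim x s)
  ... | inj₂ k    = ≼-weaken ∈-++⁺ˡ (κ (S ─ i) k)

  -- Every `compare` along the path to `x` meets its own position, so `compare-refl` reduces the map
  -- to `s` from `x` downwards.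
  content-wrap : (x : Node S) (s : Sim m (content x) R) (z : Node (content x)) →
                 content (simFun (wrapSim x s) (x ⊕ z)) ≡ content (simFun s z)
  content-wrap root s z = refl
  content-wrap (down i x) s z rewrite compare-refl i = content-wrap x s z

  content-wrap-root : (x : Node S) (s : Sim m (content x) R) →
                      content (simFun (wrapSim x s) x) ≡ R
  content-wrap-root {R = R} x s =
    subst (λ y → content (simFun (wrapSim x s) y) ≡ R) (⊕-root x) (content-wrap x s root)

  -- The passage from a conclusion to a premiss, where `N` takes the place of `it`. For a left rule,
  -- `p` says that `N` holds `it` intact or decomposed; for a right rule it is vacuous, with `m`
  -- false.
  module Replace (x : Node S) (i : it ∈ content x) {N : Seq} (p : it ≼[ m ] N) where

    local : Sim m (content x) (K (content x ─ i) ++ N)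
    local j with compare i j
    ... | inj₁ refl = ≼-weaken (∈-++⁺ʳ (K (content x ─ i))) p
    ... | inj₂ k    = ≼-weaken ∈-++⁺ˡ (κ (content x ─ i) k)

    sim : Sim m S (wrap K x (K (content x ─ i) ++ N))
    sim = wrapSim x local

    hom : Hom S (wrap K x (K (content x ─ i) ++ N))
    hom = simHom sim

    new : it' ∈ N → it' ∈ content (fun hom x)
    new j = subst (_ ∈_) (sym (content-wrap-root x local)) (∈-++⁺ʳ (K (content x ─ i)) j)

-- For `□•` and `◇∘`, which act on a formula and a sibling bracket at once.
module ReplaceWithChild {m} {x : Node S} (j : [ η ∶ Δ ] ∈ content x) (i : it ∈ (content x ─ j))
                        {N : Seq} (p : it ≼[ m ] N) (q : [ η ∶ Δ' ] ∈ N) (s : Sim m Δ Δ') where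

  rest : Seq
  rest = (content x ─ j) ─ i

  local : Sim m (content x) (rest ++ N)
  local k with compare j k
  ... | inj₁ refl = box (∈-++⁺ʳ rest q) s
  ... | inj₂ l with compare i l
  ...   | inj₁ refl = ≼-weaken (∈-++⁺ʳ rest) p
  ...   | inj₂ l'   = ≼-weaken ∈-++⁺ˡ (∈⇒≼ _ l')

  sim : Sim m S (wrap id x (rest ++ N))
  sim = wrapSim id-sim x local

  hom : Hom S (wrap id x (rest ++ N))
  hom = simHom sim

  content-child : content (fun hom (x ⊕ down j root)) ≡ Δ'
  content-child = trans (content-wrap id-sim x local (down j root)) local-child
    where
    local-child : content (simFun local (down j root)) ≡ Δ'
    local-child rewrite compare-refl j = refl

  perm : ∀ {c} → rest ++ it ∷ c ∷ [] ↭ (content x ─ j) ++ c ∷ []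
  perm = ↭-readd i _

-- Rules applied at a node

_∙_ : Ctx → Ctx → Ctx
hole     ∙ Γ' = Γ'
(Δ ,, Γ) ∙ Γ' = Δ ,, (Γ ∙ Γ')
box φ Γ  ∙ Γ' = box φ (Γ ∙ Γ')

∙-plug : ∀ Γ Γ' → (Γ ∙ Γ') ⟨ R ⟩ ≡ Γ ⟨ Γ' ⟨ R ⟩ ⟩
∙-plug hole     Γ' = refl
∙-plug (Δ ,, Γ) Γ' = cong (Δ ++_) (∙-plug Γ Γ')
∙-plug (box φ Γ) Γ' = cong (λ T → [ φ ∶ T ] ∷ []) (∙-plug Γ Γ')

ctx : Node S → Ctx → Ctx
ctx root E = E
ctx (down {η = η} {S = S} i x) E = (S ─ i) ,, box η (ctx x E)

ctx-plug : (x : Node S) (E : Ctx) → ctx x E ⟨ R ⟩ ≡ wrap id x (E ⟨ R ⟩)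
ctx-plug root E = refl
ctx-plug (down {η = η} {S = S} i x) E = cong (λ T → (S ─ i) ++ [ η ∶ T ] ∷ []) (ctx-plug x E)

ctx-↓-plug : (x : Node S) (E : Ctx) → (ctx x E ↓) ⟨ R ⟩ ≡ wrap delOutS x ((E ↓) ⟨ R ⟩)
ctx-↓-plug root E = refl
ctx-↓-plug (down {η = η} {S = S} i x) E =
  cong (λ T → delOutS (S ─ i) ++ [ η ∶ T ] ∷ []) (ctx-↓-plug x E)

-- `wrap` moves the bracket on the path to the end of its level. Generalising over the outer context
-- `Γ` lets `ex` undo this at every depth.
unwrap : ∀ Γ (x : Node S) → R ↭ content x → N⊢ (Γ ⟨ wrap id x R ⟩) → N⊢ (Γ ⟨ S ⟩)
unwrap Γ root p d = ex Γ p d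
unwrap Γ (down {η = η} {S = S} i x) p d = ex Γ (↭-readd₁ i)
  (subst N⊢_ (∙-plug Γ E) (unwrap (Γ ∙ E) x p (subst N⊢_ (sym (∙-plug Γ E)) d)))
  where
  E = (S ─ i) ,, box η hole

module At (x : Node S) (Δ : Seq) where

  Γ : Ctx
  Γ = ctx x (Δ ,, hole)

  premiss : N⊢ (wrap id x (Δ ++ R)) → N⊢ (Γ ⟨ R ⟩)
  premiss = subst N⊢_ (sym (ctx-plug x _))

  premiss↓ : N⊢ (wrap delOutS x (delOutS Δ ++ R)) → N⊢ ((Γ ↓) ⟨ R ⟩)
  premiss↓ = subst N⊢_ (sym (ctx-↓-plug x _))

  conclusion : Δ ++ R ↭ content x → N⊢ (Γ ⟨ R ⟩) → N⊢ S
  conclusion p d = unwrap hole x p (subst N⊢_ (ctx-plug x _) d)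

-- The interpretation

Prop : Set₁
Prop = ∀ {S} → Node S → Set

Monotone : Prop → Set
Monotone P = ∀ {S S'} (h : Hom S S') {x : Node S} → P x → P (fun h x)

-- `h` is arbitrary, so that the goal may change and the predicate is monotone; `k` keeps outputs,
-- so that a right rule still finds its principal formula when the continuation runs.
Closure : Prop → Prop
Closure P {S} x = ∀ {S'} (h : Hom S S') →
  (∀ {S''} (k : Hom S' S'') → Outputs k → P (fun k (fun h x)) → N⊢ S'') → N⊢ S'

Rep : Fm → Prop → Set
Rep η P = (∀ {S} {x : Node S} → (• η) ∈ content x → P x)
        × (∀ {S} {x : Node S} → P x → (∘ η) ∈ content x → N⊢ S)

⟦_⟧ : Fm → Prop
⟦ var p ⟧         = Closure (λ x → Has x (var p))
⟦ ⊥' ⟧            = Closure (λ _ → ⊥)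
⟦ φ ∧ ψ ⟧ x       = ⟦ φ ⟧ x × ⟦ ψ ⟧ x
⟦ φ ∨ ψ ⟧         = Closure (λ x → ⟦ φ ⟧ x ⊎ ⟦ ψ ⟧ x)
⟦ φ ⇒ ψ ⟧ {S} x   = ∀ {S'} (h : Hom S S') → ⟦ φ ⟧ (fun h x) → ⟦ ψ ⟧ (fun h x)
⟦ φ □→ ψ ⟧ {S} x  = ∀ {S'} (h : Hom S S') {η y} → Child (fun h x) η y → Rep η ⟦ φ ⟧ → ⟦ ψ ⟧ y
⟦ φ ◇→ ψ ⟧        = Closure (λ x → ∃[ η ] ∃[ y ] Child x η y × Rep η ⟦ φ ⟧ × ⟦ ψ ⟧ y)

mono : ∀ φ → Monotone ⟦ φ ⟧
mono (var p)   h c h' = c (h ⨾ h')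
mono ⊥'        h c h' = c (h ⨾ h')
mono (φ ∧ ψ)   h (a , b) = mono φ h a , mono ψ h b
mono (φ ∨ ψ)   h c h' = c (h ⨾ h')
mono (φ ⇒ ψ)   h f h' = f (h ⨾ h')
mono (φ □→ ψ)  h f h' = f (h ⨾ h')
mono (φ ◇→ ψ)  h c h' = c (h ⨾ h')

join : (P : Prop) (x : Node S) → Closure (Closure P) x → Closure P x
join P x c h k = c h λ k₁ o₁ c' → c' idHom λ k₂ o₂ → k (k₁ ⨾ k₂) (λ x → o₂ _ ∘ o₁ x)

-- Lets disjunctions be eliminated and left rules be applied while aiming at an arbitrary formula.
-- `∧`, `⇒` and `□→` inherit this from their parts; the other cases are closures already.
closed : ∀ φ {x : Node S} → Closure ⟦ φ ⟧ x → ⟦ φ ⟧ x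
closed (var p)  {x} = join (λ y → Has y (var p)) x
closed ⊥'       {x} = join (λ _ → ⊥) x
closed (φ ∧ ψ) c = closed φ (λ h k → c h λ k₁ o₁ p → k k₁ o₁ (proj₁ p))
                 , closed ψ (λ h k → c h λ k₁ o₁ p → k k₁ o₁ (proj₂ p))
closed (φ ∨ ψ)  {x} = join (λ y → ⟦ φ ⟧ y ⊎ ⟦ ψ ⟧ y) x
closed (φ ⇒ ψ) c h a = closed ψ λ h' k → c (h ⨾ h') λ k₁ o₁ f →
  k k₁ o₁ (f idHom (mono φ (h' ⨾ k₁) a))
closed (φ □→ ψ) c h r s = closed ψ λ h' k → c (h ⨾ h') λ k₁ o₁ f →
  k k₁ o₁ (f idHom (child (h' ⨾ k₁) r) s)
closed (φ ◇→ ψ) {x} = join (λ y → ∃[ η ] ∃[ z ] Child y η z × Rep η ⟦ φ ⟧ × ⟦ ψ ⟧ z) x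

∨-intro₁ : ∀ φ ψ {x : Node S} → ⟦ φ ⟧ x → ⟦ φ ∨ ψ ⟧ x
∨-intro₁ φ ψ a h k = k idHom (λ _ → id) (inj₁ (mono φ h a))

∨-intro₂ : ∀ φ ψ {x : Node S} → ⟦ ψ ⟧ x → ⟦ φ ∨ ψ ⟧ x
∨-intro₂ φ ψ a h k = k idHom (λ _ → id) (inj₂ (mono ψ h a))

◇-intro : ∀ φ ψ {x y : Node S} → Child x η y → Rep η ⟦ φ ⟧ → ⟦ ψ ⟧ y → ⟦ φ ◇→ ψ ⟧ x
◇-intro φ ψ c r a h k = k idHom (λ _ → id) (_ , _ , child h c , r , mono ψ h a)

-- Cut-free derivability and the interpretation

-- Recursion on `φ`, simultaneous with `reify`. If a homomorphism has already decomposed the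
-- formula, its parts are reflected directly; if it is still present, its left rule is applied and
-- the continuation derives the premisses in which the parts have become available.
reflect : ∀ φ {x : Node S} → Has x φ → ⟦ φ ⟧ x
reify   : ∀ φ {x : Node S} → ⟦ φ ⟧ x → (∘ φ) ∈ content x → N⊢ S

-- Serves the brackets created by `◇•` and `□∘`, whose index is `φ` itself.
represents : ∀ φ → Rep φ ⟦ φ ⟧
represents φ = reflect φ ∘ mem , reify φ

reflect (var p) a h k = k idHom (λ _ → id) (Has-mono h a)
reflect ⊥' {x} (mem i) h k with input h {x} i
... | mem j = conclusion (↭-readd₁ j) (⊥• Γ)
  where open At (fun h x) (content (fun h x) ─ j)
reflect (φ ∧ ψ) (and p q) = reflect φ p , reflect ψ q
reflect (φ ∧ ψ) {x} (mem i) = closed φ (λ h → go proj₁ h (input h i)) , closed ψ (λ h → go proj₂ h (input h i))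
  where
  -- The projection is a parameter, so that one argument with `∧•` serves both conjuncts.
  go : ∀ {P : Prop} → (∀ {S} {y : Node S} → ⟦ φ ⟧ y × ⟦ ψ ⟧ y → P y) →
       ∀ {S'} (h : Hom _ S') → Has (fun h x) (φ ∧ ψ) →
       (∀ {S''} (k : Hom S' S'') → Outputs k → P (fun k (fun h x)) → N⊢ S'') → N⊢ S'
  go pr h (and p q) k = k idHom (λ _ → id) (pr (reflect φ p , reflect ψ q))
  go pr h (mem j)   k = conclusion (↭-readd₁ j) (∧• Γ (premiss
      (k hom (simOutput sim) (pr (reflect φ (mem (new (here refl))) , reflect ψ (mem (new (there (here refl)))))))))
    where
    y = fun h x
    open At y (content y ─ j)
    open Replace {m = true} id-sim y j {N = (• φ) ∷ (• ψ) ∷ []} (inp (and (mem (here refl)) (mem (there (here refl)))))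
reflect (φ ∨ ψ) (or₁ p) = ∨-intro₁ φ ψ (reflect φ p)
reflect (φ ∨ ψ) (or₂ p) = ∨-intro₂ φ ψ (reflect ψ p)
reflect (φ ∨ ψ) {x} (mem i) h k with input h {x} i
... | or₁ p = k idHom (λ _ → id) (inj₁ (reflect φ p))
... | or₂ p = k idHom (λ _ → id) (inj₂ (reflect ψ p))
... | mem j = conclusion (↭-readd₁ j) (∨• Γ
      (premiss (k L.hom (simOutput L.sim) (inj₁ (reflect φ (mem (L.new (here refl)))))))
      (premiss (k M.hom (simOutput M.sim) (inj₂ (reflect ψ (mem (M.new (here refl))))))))
  where
  y = fun h x
  open At y (content y ─ j)
  module L = Replace {m = true} id-sim y j {N = (• φ) ∷ []} (inp (or₁ (mem (here refl))))
  module M = Replace {m = true} id-sim y j {N = (• ψ) ∷ []} (inp (or₂ (mem (here refl))))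
reflect (φ ⇒ ψ) {x} p h a = closed ψ λ h' → go h' (Has-mono (h ⨾ h') p)
  where
  go : ∀ {S'} (h' : Hom _ S') → Has (fun h' (fun h x)) (φ ⇒ ψ) →
       (∀ {S''} (k : Hom S' S'') → Outputs k → ⟦ ψ ⟧ (fun k (fun h' (fun h x))) → N⊢ S'') → N⊢ S'
  go h' (imp q) k = k idHom (λ _ → id) (reflect ψ q)
  go h' (mem j) k = conclusion (↭-readd₁ j) (⇒• Γ
      -- `a` survives the deletion of outputs, being monotone under all homomorphisms, and is
      -- reified at the new output `∘ φ`.
      (premiss↓ (reify φ (mono φ (h' ⨾ L.hom) a) (L.new (there (here refl)))))
      (premiss (k M.hom (simOutput M.sim) (reflect ψ (mem (M.new (here refl)))))))
    where
    y = fun h' (fun h x)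
    open At y (content y ─ j)
    module L = Replace {m = false} delOut-sim y j {N = (• (φ ⇒ ψ)) ∷ (∘ φ) ∷ []} (inp (mem (here refl)))
    module M = Replace {m = true} id-sim y j {N = (• ψ) ∷ []} (inp (imp (mem (here refl))))
reflect (φ □→ ψ) {x} p h {η} {y} c (r₁ , r₂) = closed ψ λ h' → go h' (Has-mono (h ⨾ h') p) (Child-⊕ (child h' c))
  where
  go : ∀ {S'} (h' : Hom _ S') → Has (fun h' (fun h x)) (φ □→ ψ) →
       ∃[ Δ ] ∃[ j ] fun h' y ≡ fun h' (fun h x) ⊕ down {η = η} {Δ = Δ} j root →
       (∀ {S''} (k : Hom S' S'') → Outputs k → ⟦ ψ ⟧ (fun k (fun h' y)) → N⊢ S'') → N⊢ S'
  -- An input formula and a bracket cannot share a position, so only `inj₂` remains.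
  go h' (mem i) (Δ , j , eq) k with compare j i
  ... | inj₂ i' = conclusion (↭-trans perm (↭-readd₁ j)) (□• Γ
        -- Both index premisses come from `Rep η ⟦ φ ⟧`, taken at the root of a two-item sequent.
        (r₂ {x = root} (reflect φ (mem (here refl))) (there (here refl)))
        (reify φ {x = root} (r₁ (here refl)) (there (here refl)))
        (premiss (k hom (simOutput sim) (reflect ψ (mem new)))))
    where
    z = fun h' (fun h x)
    open At z ((content z ─ j) ─ i')
    open ReplaceWithChild {m = true} {x = z} j i'
           {N = (• (φ □→ ψ)) ∷ [ η ∶ (• ψ) ∷ Δ ] ∷ []} (inp (mem (here refl))) (there (here refl)) (⊆-sim there)
    new : (• ψ) ∈ content (fun hom (fun h' y))
    new = subst (λ w → (• ψ) ∈ content (fun hom w)) (sym eq) (subst ((• ψ) ∈_) (sym content-child) (here refl))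
reflect (φ ◇→ ψ) (dia c p) = ◇-intro φ ψ c (represents φ) (reflect ψ p)
reflect (φ ◇→ ψ) {x} (mem i) h k with input h {x} i
... | dia c p = k idHom (λ _ → id) (_ , _ , c , represents φ , reflect ψ p)
... | mem j = conclusion (↭-readd₁ j) (◇• Γ (premiss
      (k hom (simOutput sim)
        (_ , _ , ⊕-child (fun hom y) bracket , represents φ , reflect ψ (mem (∈-⊕ (fun hom y) bracket (here refl)))))))
  where
  y = fun h x
  open At y (content y ─ j)
  open Replace {m = true} id-sim y j {N = [ φ ∶ (• ψ) ∷ [] ] ∷ []} (inp (dia (top (here refl)) (mem (here refl))))
  bracket = new (here refl)

-- `keep` carries the output to the sequent reached by the closure; there the input variable is
-- literally present, since only `mem` yields a variable.
reify (var p) c o = c idHom λ k keep a → go a (keep _ o)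
  where
  go : {x : Node S} → Has x (var p) → (∘ var p) ∈ content x → N⊢ S
  go {x = x} (mem i) o with compare i o
  ... | inj₂ o' = conclusion (↭-trans ↭-swap-end (↭-readd₁ i)) (init Γ p)
    where
    open At x ((content x ─ i) ─ o')
    ↭-swap-end : ((content x ─ i) ─ o') ++ (• var p) ∷ (∘ var p) ∷ [] ↭ (content x ─ i) ++ (• var p) ∷ []
    ↭-swap-end = ↭-trans (++⁺ˡ ((content x ─ i) ─ o') (swap _ _ ↭-refl)) (↭-readd o' _)
reify ⊥' c o = c idHom λ _ _ ()
reify (φ ∧ ψ) {x} (a , b) o = conclusion (↭-readd₁ o) (∧∘ Γ
    (premiss (reify φ (mono φ L.hom a) (L.new (here refl))))
    (premiss (reify ψ (mono ψ M.hom b) (M.new (here refl)))))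
  where
  open At x (content x ─ o)
  module L = Replace {m = false} id-sim x o {N = (∘ φ) ∷ []} (out λ ())
  module M = Replace {m = false} id-sim x o {N = (∘ ψ) ∷ []} (out λ ())
reify (φ ∨ ψ) c o = c idHom λ k keep a → go a (keep _ o)
  where
  go : {x : Node S} → ⟦ φ ⟧ x ⊎ ⟦ ψ ⟧ x → (∘ (φ ∨ ψ)) ∈ content x → N⊢ S
  go {x = x} (inj₁ a) o = conclusion (↭-readd₁ o) (∨∘₁ Γ
      (premiss (reify φ (mono φ hom a) (new (here refl)))))
    where
    open At x (content x ─ o)
    open Replace {m = false} id-sim x o {N = (∘ φ) ∷ []} (out λ ())
  go {x = x} (inj₂ b) o = conclusion (↭-readd₁ o) (∨∘₂ Γ
      (premiss (reify ψ (mono ψ hom b) (new (here refl)))))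
    where
    open At x (content x ─ o)
    open Replace {m = false} id-sim x o {N = (∘ ψ) ∷ []} (out λ ())
reify (φ ⇒ ψ) {x} f o = conclusion (↭-readd₁ o) (⇒∘ Γ
    (premiss (reify ψ (f hom (reflect φ (mem (new (here refl))))) (new (there (here refl))))))
  where
  open At x (content x ─ o)
  open Replace {m = false} id-sim x o {N = (• φ) ∷ (∘ ψ) ∷ []} (out λ ())
reify (φ □→ ψ) {x} f o = conclusion (↭-readd₁ o) (□∘ Γ
    -- The new bracket is a child with index `φ`, so `f` applies to it.
    (premiss (reify ψ (f hom (⊕-child (fun hom x) bracket) (represents φ)) (∈-⊕ (fun hom x) bracket (here refl)))))
  where
  open At x (content x ─ o)
  open Replace {m = false} id-sim x o {N = [ φ ∶ (∘ ψ) ∷ [] ] ∷ []} (out λ ())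
  bracket = new (here refl)
reify (φ ◇→ ψ) c o = c idHom λ { k keep (η , y , r , s , a) → go (Child-⊕ r) s a (keep _ o) }
  where
  go : {x y : Node S} → ∃[ Δ ] ∃[ j ] y ≡ x ⊕ down {η = η} {Δ = Δ} j root →
       Rep η ⟦ φ ⟧ → ⟦ ψ ⟧ y → (∘ (φ ◇→ ψ)) ∈ content x → N⊢ S
  go {η = η} {x = x} (Δ , j , refl) (r₁ , r₂) a o with compare j o
  ... | inj₂ o' = conclusion (↭-trans perm (↭-readd₁ j)) (◇∘ Γ
        (r₂ {x = root} (reflect φ (mem (here refl))) (there (here refl)))
        (reify φ {x = root} (r₁ (here refl)) (there (here refl)))
        (premiss (reify ψ (mono ψ hom a) (subst ((∘ ψ) ∈_) (sym content-child) (here refl)))))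
    where
    open At x ((content x ─ j) ─ o')
    open ReplaceWithChild {m = false} {x = x} j o'
           {N = [ η ∶ (∘ ψ) ∷ Δ ] ∷ []} (out λ ()) (here refl) (⊆-sim there)

-- Soundness of IntCK

-- The reason for `Rep`: indices count only up to equivalence of interpretations, which validates
-- `RA□` and `RA◇`.
Rep-resp : {P Q : Prop} → (∀ {S} {x : Node S} → P x → Q x) → (∀ {S} {x : Node S} → Q x → P x) →
           Rep η P → Rep η Q
Rep-resp P⇒Q Q⇒P (r₁ , r₂) = P⇒Q ∘ r₁ , r₂ ∘ Q⇒P

◇-map : ∀ {φ ψ φ' ψ'} → (∀ {η} → Rep η ⟦ φ ⟧ → Rep η ⟦ φ' ⟧) → (∀ {S} {x : Node S} → ⟦ ψ ⟧ x → ⟦ ψ' ⟧ x) →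
        {x : Node S} → ⟦ φ ◇→ ψ ⟧ x → ⟦ φ' ◇→ ψ' ⟧ x
◇-map f g c h k = c h λ { k₁ o₁ (_ , _ , r , s , a) → k k₁ o₁ (_ , _ , r , f s , g a) }

sound : ⊢ φ → (x : Node S) → ⟦ φ ⟧ x

module _ (d : ⊢ (φ ⇔ ψ)) where

  sound-⇔₁ : {x : Node S} → ⟦ φ ⟧ x → ⟦ ψ ⟧ x
  sound-⇔₁ {x = x} = proj₁ (sound d x) idHom

  sound-⇔₂ : {x : Node S} → ⟦ ψ ⟧ x → ⟦ φ ⟧ x
  sound-⇔₂ {x = x} = proj₂ (sound d x) idHom

  Rep-⇔₁ : Rep η ⟦ φ ⟧ → Rep η ⟦ ψ ⟧
  Rep-⇔₁ = Rep-resp {P = ⟦ φ ⟧} {Q = ⟦ ψ ⟧} sound-⇔₁ sound-⇔₂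

  Rep-⇔₂ : Rep η ⟦ ψ ⟧ → Rep η ⟦ φ ⟧
  Rep-⇔₂ = Rep-resp {P = ⟦ ψ ⟧} {Q = ⟦ φ ⟧} sound-⇔₂ sound-⇔₁

sound (ax-K {φ}) x h a h' b = mono φ h' a
sound ax-S x h f h' g h'' a = f (h' ⨾ h'') a idHom (g h'' a)
sound ax-∧E₁ x h = proj₁
sound ax-∧E₂ x h = proj₂
sound (ax-∧I {φ}) x h a h' b = mono φ h' a , b
sound (ax-∨I₁ {φ} {ψ}) x h = ∨-intro₁ φ ψ
sound (ax-∨I₂ {φ} {ψ}) x h = ∨-intro₂ φ ψ
sound (ax-∨E {χ = χ}) x h f h' g h'' c = closed χ λ h₃ k → c h₃ λ where
  k₁ o₁ (inj₁ a) → k k₁ o₁ (f (h' ⨾ h'' ⨾ h₃ ⨾ k₁) a)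
  k₁ o₁ (inj₂ b) → k k₁ o₁ (g (h'' ⨾ h₃ ⨾ k₁) b)
sound (ax-⊥E {φ}) x h c = closed φ λ h' k → c h' λ _ _ ()
sound (mp d e) x = sound d x idHom (sound e x)
sound CM□ x h f = (λ h' c r → proj₁ (f h' c r)) , (λ h' c r → proj₂ (f h' c r))
sound CC□ x h (f , g) h' c r = f h' c r , g h' c r
sound CN□ x h c r h' e = e
sound (CM◇ {φ} {ψ} {χ}) x h c = closed (φ ◇→ ψ ∨ χ) λ h' k → c h' λ where
  k₁ o₁ (inj₁ d) → k k₁ o₁ (◇-map {φ = φ} {ψ} {φ} {ψ ∨ χ} id (∨-intro₁ ψ χ) d)
  k₁ o₁ (inj₂ d) → k k₁ o₁ (◇-map {φ = φ} {χ} {φ} {ψ ∨ χ} id (∨-intro₂ ψ χ) d)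
sound (CC◇ {φ} {ψ} {χ}) x h c h' k = c h' λ where
  -- The answer concerns the whole sequent, so a disjunction held at the child can be resolved while
  -- the goal sits at the parent.
  k₁ o₁ (_ , _ , r , s , d) → d idHom λ where
    k₂ o₂ (inj₁ a) → k (k₁ ⨾ k₂) (λ x → o₂ _ ∘ o₁ x) (inj₁ (◇-intro φ ψ (child k₂ r) s a))
    k₂ o₂ (inj₂ b) → k (k₁ ⨾ k₂) (λ x → o₂ _ ∘ o₁ x) (inj₂ (◇-intro φ χ (child k₂ r) s b))
sound CN◇ x h c h' k = c h' λ where
  k₁ o₁ (_ , _ , _ , _ , d) → d idHom λ _ _ ()
sound CW x h (c , f) h' k = c h' λ where
  k₁ o₁ (_ , _ , r , s , a) → k k₁ o₁ (_ , _ , r , s , a , f (h' ⨾ k₁) r s)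
-- Once `ψ` holds at the child, that child witnesses `φ ◇→ ψ` at its parent, and the `□→` obtained
-- from `f` is used at the same child.
sound (CFS {φ} {ψ}) x h f h' r s h'' a = f (h' ⨾ h'') (◇-intro φ ψ (child h'' r) s a) idHom (child h'' r) s
sound (RA□ d) x = (λ h f h' r s → f h' r (Rep-⇔₂ d s)) , (λ h f h' r s → f h' r (Rep-⇔₁ d s))
sound (RC□ d) x = (λ h f h' r s → sound-⇔₁ d (f h' r s)) , (λ h f h' r s → sound-⇔₂ d (f h' r s))
sound (RA◇ {φ} {ρ} {ψ} d) x =
  (λ h → ◇-map {φ = φ} {ψ} {ρ} {ψ} (Rep-⇔₁ d) id) , (λ h → ◇-map {φ = ρ} {ψ} {φ} {ψ} (Rep-⇔₂ d) id)
sound (RC◇ {φ} {ψ} {χ} d) x =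
  (λ h → ◇-map {φ = φ} {ψ} {φ} {χ} id (sound-⇔₁ d)) , (λ h → ◇-map {φ = φ} {χ} {φ} {ψ} id (sound-⇔₂ d))

-- Derivability from assumptions

⋀-intro : ∀ ψs {x : Node S} → All (λ ψ → ⟦ ψ ⟧ x) ψs → ⟦ ⋀ ψs ⟧ x
⋀-intro []            []       h e = e
⋀-intro (ψ ∷ [])      (a ∷ []) = a
⋀-intro (ψ ∷ ψ' ∷ ψs) (a ∷ as) = a , ⋀-intro (ψ' ∷ ψs) as

theorem3 : (A : List Fm) (φ : Fm) → Unique A → A ⊢IntCK φ → N⊢ (• A ,∘ φ)
theorem3 A φ _ (ψs , ψs⊆A , d) =
  reify φ {x = root} (sound d root idHom (⋀-intro ψs (All.map assumption ψs⊆A)))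
    (∈-++⁺ʳ (map •_ A) (here refl))
  where
  assumption : ψ ∈ A → ⟦ ψ ⟧ {• A ,∘ φ} root
  assumption {ψ} i = reflect ψ (mem (∈-++⁺ˡ (∈-map⁺ •_ i)))
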